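{- Let $A$ be an $m\times n$ matrix with $m\ge n$ such that every square submatrix of $A$ is nonsingular. Then $A$ has rank $n$ and $A$ is completely unsparsifiable, i.e. $\operatorname{nnz}(AX)\ge (m-n+1)n$ for every invertible $n\times n$ matrix $X$. Moreover, the $(n+m)\times n$ matrix $\begin{pmatrix} I_n\\ A\end{pmatrix}$ (the $n\times n$ identity stacked above $A$) is optimally sparse.
   Context: $\operatorname{nnz}(M)$ is the number of nonzero entries of $M$. A matrix $M$ with $k$ columns is optimally sparse if $\operatorname{nnz}(MX)\ge\operatorname{nnz}(M)$ for every invertible $k\times k$ matrix $X$. A square submatrix of $A$ is $A(R,C)$ for row set $R$ and column set $C$ with $|R|=|C|\ge 1$. -}

module Defs where

open import Algebra.Apartness.Bundles using (HeytingCommutativeRing; HeytingField)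
open import Algebra.Bundles using (CommutativeRing)
import Algebra.Definitions
import Algebra.Properties.CommutativeMonoid.Sum as Sum
open import Data.Bool.Base using (if_then_else_)
open import Data.Fin.Base using (Fin; _<_)
open import Data.Fin.Properties using (_≟_)
open import Data.Nat.Base as ℕ using (ℕ; NonZero)
open import Data.Nat.Properties using (+-0-commutativeMonoid)
open import Data.Product.Base using (∃-syntax; _×_)
open import Data.Vec.Functional using (Vector; transpose)
open import Level using (_⊔_)
open import Relation.Binary.Core using (_Preserves_⟶_)
open import Relation.Binary.Definitions using (Decidable)
open import Relation.Nullary.Decidable.Core using (does)

-- A Heyting field whose apartness is decidable is a discrete field: by
-- tightness x # y is equivalent to ¬ (x ≈ y), and every x # 0# is invertible.
-- Decidability is what makes the number of nonzero entries a natural number.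
module Matrices {c ℓ₁ ℓ₂} (F : HeytingField c ℓ₁ ℓ₂)
                (_#?_ : Decidable (HeytingField._#_ F)) where

  open HeytingField F using (Carrier; _≈_; _*_; 0#; 1#; heytingCommutativeRing)
  open HeytingCommutativeRing heytingCommutativeRing using (commutativeRing)

  private
    module ΣF = Sum (CommutativeRing.+-commutativeMonoid commutativeRing)
    module Σℕ = Sum +-0-commutativeMonoid

  Matrix : ℕ → ℕ → Set c
  Matrix m n = Vector (Vector Carrier n) m

  infix  4 _≋_
  infixl 7 _·_

  _≋_ : ∀ {m n} → Matrix m n → Matrix m n → Set ℓ₁
  A ≋ B = ∀ i j → A i j ≈ B i j

  _·_ : ∀ {m n p} → Matrix m n → Matrix n p → Matrix m p
  _·_ {n = n} A B i j = ΣF.sum {n} λ k → A i k * B k j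

  I : ∀ {n} → Matrix n n
  I i j = if does (i ≟ j) then 1# else 0#

  Invertible : ∀ {k} → Matrix k k → Set (c ⊔ ℓ₁)
  Invertible {k} = Algebra.Definitions.Invertible (_≋_ {k} {k}) I _·_

  Nonsingular : ∀ {k} → Matrix k k → Set (c ⊔ ℓ₁)
  Nonsingular = Invertible

  -- A k-element row set R ⊆ Fin m is given by its increasing enumeration
  -- ρ : Fin k → Fin m, and likewise a column set C by γ, so that A(R,C) is
  -- the matrix with entries A (ρ i) (γ j).
  EverySquareSubmatrixNonsingular : ∀ {m n} → Matrix m n → Set (c ⊔ ℓ₁)
  EverySquareSubmatrixNonsingular {m} {n} A =
    ∀ k → .{{_ : NonZero k}} →
    (ρ : Fin k → Fin m) → ρ Preserves _<_ ⟶ _<_ →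
    (γ : Fin k → Fin n) → γ Preserves _<_ ⟶ _<_ →
    Nonsingular (λ i j → A (ρ i) (γ j))

  linearCombination : ∀ {r m} → Vector Carrier r → Vector (Vector Carrier m) r →
                      Vector Carrier m
  linearCombination {r} a v i = ΣF.sum {r} λ k → a k * v k i

  Span : ∀ {r m} → Vector (Vector Carrier m) r → Vector Carrier m → Set (c ⊔ ℓ₁)
  Span v w = ∃[ a ] (∀ i → w i ≈ linearCombination a v i)

  LinearlyIndependent : ∀ {r m} → Vector (Vector Carrier m) r → Set (c ⊔ ℓ₁)
  LinearlyIndependent v =
    ∀ a → (∀ i → linearCombination a v i ≈ 0#) → ∀ k → a k ≈ 0#

  IsBasis : ∀ {ℓ r m} → (Vector Carrier m → Set ℓ) →
            Vector (Vector Carrier m) r → Set (c ⊔ ℓ₁ ⊔ ℓ)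
  IsBasis U b =
    (∀ k → U (b k)) × LinearlyIndependent b × (∀ w → U w → Span b w)

  ColumnSpace : ∀ {m n} → Matrix m n → Vector Carrier m → Set (c ⊔ ℓ₁)
  ColumnSpace A = Span (transpose A)

  -- The rank is the dimension of the column space.
  HasRank : ∀ {m n} → Matrix m n → ℕ → Set (c ⊔ ℓ₁)
  HasRank {m} A r =
    ∃[ b ] IsBasis {r = r} {m = m} (ColumnSpace A) b

  nnz : ∀ {m n} → Matrix m n → ℕ
  nnz {m} {n} M =
    Σℕ.sum {m} λ i → Σℕ.sum {n} λ j → if does (M i j #? 0#) then 1 else 0

  -- Truncated subtraction is only meaningful here for n ≤ m.
  CompletelyUnsparsifiable : ∀ {m n} → Matrix m n → Set (c ⊔ ℓ₁)
  CompletelyUnsparsifiable {m} {n} A =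
    (X : Matrix n n) → Invertible X → (m ℕ.∸ n ℕ.+ 1) ℕ.* n ℕ.≤ nnz (A · X)

  OptimallySparse : ∀ {m k} → Matrix m k → Set (c ⊔ ℓ₁)
  OptimallySparse {m} {k} M =
    (X : Matrix k k) → Invertible X → nnz M ℕ.≤ nnz (M · X)

{-# OPTIONS --safe #-}

-- For every nonzero vector x, the product A x has fewer zero entries than x has
-- nonzero entries.  Otherwise let C be the support of x and R a set of |C| zero
-- entries of A x: then A(R,C) annihilates the restriction of x to C, although
-- A(R,C) is nonsingular.  Hence nnz x + nnz (A x) > m, and this is applied to
-- the columns of X.
module Submission where

open import Defs
open import Algebra.Apartness.Bundles using (HeytingField; HeytingCommutativeRing)
import Algebra.Apartness.Properties.HeytingCommutativeRing as HeytingProperties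
open import Algebra.Bundles using (CommutativeRing)
import Algebra.Properties.CommutativeMonoid.Sum as CommutativeMonoidSum
import Algebra.Properties.Semiring.Sum as SemiringSum
open import Data.Bool.Base using (if_then_else_)
open import Data.Fin.Base as Fin using (Fin; zero; suc; inject≤; fromℕ<; _↑ˡ_; _↑ʳ_)
open import Data.Fin.Properties using (_≟_; any?; nonZeroIndex; toℕ-inject≤)
open import Data.Nat.Base as ℕ using (ℕ; zero; suc; _≤_; z≤n; s≤s)
import Data.Nat.Properties as ℕ
open import Data.Product.Base using (∃-syntax; _×_; _,_; proj₁; proj₂)
open import Data.Vec.Functional using (Vector; _++_; transpose)
open import Data.Vec.Functional.Properties using (lookup-++ˡ; lookup-++ʳ)
open import Function.Base using (id; _∘_)
open import Level using (Level)
open import Relation.Binary.Core using (_Preserves_⟶_)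
open import Relation.Binary.Definitions using (Decidable)
open import Relation.Binary.PropositionalEquality as ≡ using (_≡_)
import Relation.Binary.Reasoning.Setoid as ≈-Reasoning
open import Relation.Nullary.Decidable using (yes; no; does; ¬?; dec-true)
open import Relation.Nullary.Negation using (¬_; contradiction)
open import Relation.Unary using (Pred)
import Relation.Unary as Unary

private
  module Σℕ = CommutativeMonoidSum ℕ.+-0-commutativeMonoid

  variable
    a p q : Level
    m n : ℕ

-- Sums and counts of natural numbers over `Fin n`.

sum-mono-≤ : {f g : Vector ℕ n} → (∀ i → f i ≤ g i) → Σℕ.sum f ≤ Σℕ.sum g
sum-mono-≤ {n = zero}  f≤g = z≤n
sum-mono-≤ {n = suc n} f≤g = ℕ.+-mono-≤ (f≤g zero) (sum-mono-≤ (f≤g ∘ suc))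

sum-const : ∀ n c → Σℕ.sum {n} (λ _ → c) ≡ n ℕ.* c
sum-const zero    c = ≡.refl
sum-const (suc n) c = ≡.cong (c ℕ.+_) (sum-const n c)

sum-↑ : ∀ m (f : Vector ℕ (m ℕ.+ n)) →
        Σℕ.sum f ≡ Σℕ.sum (f ∘ (_↑ˡ n)) ℕ.+ Σℕ.sum (f ∘ (m ↑ʳ_))
sum-↑ zero    f = ≡.refl
sum-↑ (suc m) f =
  ≡.trans (≡.cong (f zero ℕ.+_) (sum-↑ m (f ∘ suc))) (≡.sym (ℕ.+-assoc (f zero) _ _))

count : {P : Pred (Fin n) p} → Unary.Decidable P → ℕ
count P? = Σℕ.sum λ i → if does (P? i) then 1 else 0

count-mono : {P : Pred (Fin n) p} {Q : Pred (Fin n) q}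
             (P? : Unary.Decidable P) (Q? : Unary.Decidable Q) →
             (∀ i → P i → Q i) → count P? ≤ count Q?
count-mono {P = P} {Q} P? Q? P⊆Q = sum-mono-≤ indicator-mono
  where
  indicator-mono : ∀ i → (if does (P? i) then 1 else 0) ≤ (if does (Q? i) then 1 else 0)
  indicator-mono i with P? i | Q? i
  ... | no _   | _      = z≤n
  ... | yes _  | yes _  = ℕ.≤-refl
  ... | yes Pi | no ¬Qi = contradiction (P⊆Q i Pi) ¬Qi

count≤n : {P : Pred (Fin n) p} (P? : Unary.Decidable P) → count P? ≤ n
count≤n {n = zero}  P? = z≤n
count≤n {n = suc n} P? with P? zero
... | yes _ = s≤s (count≤n (P? ∘ suc))
... | no  _ = ℕ.m≤n⇒m≤1+n (count≤n (P? ∘ suc))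

count-∁ : {P : Pred (Fin n) p} (P? : Unary.Decidable P) →
          count P? ℕ.+ count (¬? ∘ P?) ≡ n
count-∁ {n = zero}  P? = ≡.refl
count-∁ {n = suc n} P? with P? zero
... | yes _ = ≡.cong suc (count-∁ (P? ∘ suc))
... | no  _ = ≡.trans (ℕ.+-suc _ _) (≡.cong suc (count-∁ (P? ∘ suc)))

count-≟ : (j : Fin n) → count (_≟ j) ≡ 1
count-≟ {n = suc n} zero = ≡.cong suc (Σℕ.sum-replicate-zero n)
-- The indicator at `zero` reduces to 0 and `does (suc i ≟ suc j)` to `does (i ≟ j)`, so the
-- recursive equation has the required type by computation.
count-≟ (suc j) = count-≟ j

count-positive : {P : Pred (Fin n) p} (P? : Unary.Decidable P) →
                 ∀ j → P j → 1 ≤ count P?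
count-positive {P = P} P? j Pj = ≡.subst (_≤ count P?) (count-≟ j)
  (count-mono (_≟ j) P? λ i i≡j → ≡.subst P (≡.sym i≡j) Pj)

-- The elements of type `A` will be whole rows of a stacked matrix, tested either by one entry or by
-- their product with a fixed vector.
count-++ : {A : Set a} {P : Pred A p} (P? : Unary.Decidable P)
           (xs : Vector A m) (ys : Vector A n) →
           count (P? ∘ (xs ++ ys)) ≡ count (P? ∘ xs) ℕ.+ count (P? ∘ ys)
count-++ {m = m} P? xs ys = ≡.trans (sum-↑ m _) (≡.cong₂ ℕ._+_
  (Σℕ.sum-cong-≗ (≡.cong indicator ∘ lookup-++ˡ xs ys))
  (Σℕ.sum-cong-≗ (≡.cong indicator ∘ lookup-++ʳ xs ys)))
  where
  indicator : _ → ℕ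
  indicator x = if does (P? x) then 1 else 0

-- Increasing enumeration of a decidable subset.

enumerate : {P : Pred (Fin n) p} (P? : Unary.Decidable P) → Fin (count P?) → Fin n
enumerate {n = suc n} P? i with P? zero
enumerate P? zero    | yes _ = zero
enumerate P? (suc i) | yes _ = suc (enumerate (P? ∘ suc) i)
enumerate P? i       | no  _ = suc (enumerate (P? ∘ suc) i)

enumerate-sound : {P : Pred (Fin n) p} (P? : Unary.Decidable P) →
                  ∀ i → P (enumerate P? i)
enumerate-sound {n = suc n} P? i with P? zero
enumerate-sound P? zero    | yes P0 = P0
enumerate-sound P? (suc i) | yes _  = enumerate-sound (P? ∘ suc) i
enumerate-sound P? i       | no  _  = enumerate-sound (P? ∘ suc) i

enumerate-mono-< : {P : Pred (Fin n) p} (P? : Unary.Decidable P) →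
                   enumerate P? Preserves Fin._<_ ⟶ Fin._<_
enumerate-mono-< {n = suc n} P? {i} {j} i<j with P? zero
enumerate-mono-< P? {zero}  {suc j} _         | yes _ = s≤s z≤n
enumerate-mono-< P? {suc i} {suc j} (s≤s i<j) | yes _ = s≤s (enumerate-mono-< (P? ∘ suc) i<j)
enumerate-mono-< P? {i}     {j}     i<j       | no  _ = s≤s (enumerate-mono-< (P? ∘ suc) i<j)

inject≤-mono-< : .(m≤n : m ≤ n) → (λ i → inject≤ i m≤n) Preserves Fin._<_ ⟶ Fin._<_
inject≤-mono-< m≤n {i} {j} =
  ≡.subst₂ ℕ._<_ (≡.sym (toℕ-inject≤ i m≤n)) (≡.sym (toℕ-inject≤ j m≤n))

-- Linear algebra over a discrete field.

module MatrixProperties {c ℓ₁ ℓ₂} (F : HeytingField c ℓ₁ ℓ₂)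
                        (_#?_ : Decidable (HeytingField._#_ F)) where

  open HeytingField F hiding (zero)
  open HeytingCommutativeRing heytingCommutativeRing using (commutativeRing)
  open CommutativeRing commutativeRing using (semiring)
  open HeytingProperties heytingCommutativeRing using (1#0; #-congʳ)
  open SemiringSum semiring
  open Matrices F _#?_

  infixr 8 _⊙_

  -- `(A · B) i j` unfolds to `A i ⊙ (λ k → B k j)`, so facts about a product A x apply to the
  -- columns of `A · X` without conversion.
  _⊙_ : Vector Carrier n → Vector Carrier n → Carrier
  x ⊙ y = sum λ k → x k * y k

  nonzero? : (x : Vector Carrier n) → Unary.Decidable (λ i → x i # 0#)
  nonzero? x i = x i #? 0#

  size : Vector Carrier n → ℕ
  size x = count (nonzero? x)

  ≈0⇒¬#0 : ∀ {x} → x ≈ 0# → ¬ x # 0#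
  ≈0⇒¬#0 = proj₂ (tight _ _)

  ¬#0⇒≈0 : ∀ {x} → ¬ x # 0# → x ≈ 0#
  ¬#0⇒≈0 = proj₁ (tight _ _)

  sum-zero : {f : Vector Carrier n} → (∀ i → f i ≈ 0#) → sum f ≈ 0#
  sum-zero {n = n} f≈0 = trans (sum-cong-≋ f≈0) (sum-replicate-zero n)

  -- The omitted terms vanish. With `P` the support of x, this identifies a row of A times x with
  -- the same row, restricted to the support, times the restricted x.
  sum-enumerate : {P : Pred (Fin n) p} (P? : Unary.Decidable P) {f : Vector Carrier n} →
                  (∀ i → ¬ P i → f i ≈ 0#) → sum (f ∘ enumerate P?) ≈ sum f
  sum-enumerate {n = zero}  P? f≈0 = refl
  sum-enumerate {n = suc n} P? f≈0 with P? zero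
  ... | yes _  = +-congˡ (sum-enumerate (P? ∘ suc) (f≈0 ∘ suc))
  ... | no ¬P0 = trans (sum-enumerate (P? ∘ suc) (f≈0 ∘ suc))
                       (sym (trans (+-congʳ (f≈0 zero ¬P0)) (+-identityˡ _)))

  I-⊙ : ∀ (i : Fin n) x → I i ⊙ x ≈ x i
  I-⊙ zero x = trans
    (+-cong (*-identityˡ _) (sum-zero (zeroˡ ∘ x ∘ suc)))
    (+-identityʳ _)
  I-⊙ (suc i) x = trans
    (+-cong (zeroˡ _) (I-⊙ i (x ∘ suc)))
    (+-identityˡ _)

  I-diagonal : (i : Fin n) → I i i ≡ 1#
  I-diagonal i = ≡.cong (λ b → if b then 1# else 0#) (dec-true (i ≟ i) ≡.refl)

  I-offDiagonal : (i j : Fin n) → I i j # 0# → i ≡ j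
  I-offDiagonal i j Iij#0 with i ≟ j
  ... | yes i≡j = i≡j
  ... | no  _   = contradiction Iij#0 (≈0⇒¬#0 refl)

  ·-⊙-assoc : ∀ {k} (A : Matrix m n) (B : Matrix n k) x i →
              (A · B) i ⊙ x ≈ A i ⊙ (λ j → B j ⊙ x)
  ·-⊙-assoc A B x i = begin
    sum (λ k → sum (λ j → A i j * B j k) * x k)
      ≈⟨ sum-cong-≋ (λ k → *-distribʳ-sum (x k) (λ j → A i j * B j k)) ⟩
    sum (λ k → sum (λ j → A i j * B j k * x k))
      ≈⟨ ∑-comm (λ k j → A i j * B j k * x k) ⟩
    sum (λ j → sum (λ k → A i j * B j k * x k))
      ≈⟨ sum-cong-≋ (λ j → sum-cong-≋ λ k → *-assoc (A i j) (B j k) (x k)) ⟩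
    sum (λ j → sum (λ k → A i j * (B j k * x k)))
      ≈⟨ sum-cong-≋ (λ j → *-distribˡ-sum (A i j) (λ k → B j k * x k)) ⟨
    sum (λ j → A i j * (B j ⊙ x)) ∎
    where open ≈-Reasoning (CommutativeRing.setoid commutativeRing)

  -- A left inverse recovers x as B⁻¹ (B x) = B⁻¹ 0 = 0.
  nonsingular⇒injective : {B : Matrix n n} → Nonsingular B →
                          ∀ x → (∀ i → B i ⊙ x ≈ 0#) → ∀ i → x i ≈ 0#
  nonsingular⇒injective {B = B} (B⁻¹ , B⁻¹B≋I , _) x Bx≈0 i = begin
    x i                       ≈⟨ I-⊙ i x ⟨
    I i ⊙ x                   ≈⟨ sum-cong-≋ (λ k → *-congʳ (B⁻¹B≋I i k)) ⟨
    (B⁻¹ · B) i ⊙ x           ≈⟨ ·-⊙-assoc B⁻¹ B x i ⟩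
    B⁻¹ i ⊙ (λ j → B j ⊙ x)   ≈⟨ sum-zero (λ j → trans (*-congˡ (Bx≈0 j)) (zeroʳ _)) ⟩
    0#                        ∎
    where open ≈-Reasoning (CommutativeRing.setoid commutativeRing)

  -- If column j of X were zero, the diagonal entry j of X⁻¹ X = I would be 0, against 1 # 0.
  invertible⇒column-nonzero : {X : Matrix n n} → Invertible X →
                              ∀ j → ∃[ i ] X i j # 0#
  invertible⇒column-nonzero {X = X} (X⁻¹ , X⁻¹X≋I , _) j
    with any? (λ i → X i j #? 0#)
  ... | yes Xij#0 = Xij#0
  ... | no  Xj≈0  = contradiction 1#0 (≈0⇒¬#0 (begin
    1#                        ≡⟨ I-diagonal j ⟨
    I j j                     ≈⟨ X⁻¹X≋I j j ⟨
    X⁻¹ j ⊙ (λ i → X i j)     ≈⟨ sum-zero (λ i → trans (*-congˡ (¬#0⇒≈0 (Xj≈0 ∘ (i ,_)))) (zeroʳ _)) ⟩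
    0#                        ∎))
    where open ≈-Reasoning (CommutativeRing.setoid commutativeRing)

  -- Column j of `A · X` depends on X only through its column j, so the bounds on `nnz` are proved
  -- column by column.
  nnz-columns : (M : Matrix m n) → nnz M ≡ Σℕ.sum (λ j → size (λ i → M i j))
  nnz-columns M = Σℕ.∑-comm (λ i j → if does (M i j #? 0#) then 1 else 0)

  -- Matrices all of whose square submatrices are nonsingular.

  module _ (A : Matrix m n) (A-nonsingular : EverySquareSubmatrixNonsingular A) where

    zeros<support : ∀ x j → x j # 0# →
                    count (¬? ∘ nonzero? (λ i → A i ⊙ x)) ℕ.< size x
    zeros<support x j xj#0 = ℕ.≰⇒> λ s≤z →
      let
        zero? = ¬? ∘ nonzero? (λ i → A i ⊙ x)
        s≥1   = count-positive (nonzero? x) j xj#0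
        -- Keeping only the first `size x` zeros of A x makes the submatrix square; `s≥1` makes it
        -- nonempty.
        ρ     = λ i → enumerate zero? (inject≤ i s≤z)
        γ     = enumerate (nonzero? x)
        Bx≈0  = λ i → trans
          (sum-enumerate (nonzero? x) λ k xk≈0 → trans (*-congˡ (¬#0⇒≈0 xk≈0)) (zeroʳ _))
          (¬#0⇒≈0 (enumerate-sound zero? (inject≤ i s≤z)))
        B-nonsingular = A-nonsingular (size x) {{ℕ.>-nonZero s≥1}}
          ρ (enumerate-mono-< zero? ∘ inject≤-mono-< s≤z)
          γ (enumerate-mono-< (nonzero? x))
        -- Any index of the support will do: injectivity forces x to vanish there.
        l     = fromℕ< s≥1
      in ≈0⇒¬#0 (nonsingular⇒injective B-nonsingular (x ∘ γ) Bx≈0 l)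
                (enumerate-sound (nonzero? x) l)

    -- The m entries of A x are either nonzero or among the zeros, which are fewer than `size x`.
    size-bound : ∀ x j → x j # 0# → m ℕ.< size x ℕ.+ size (λ i → A i ⊙ x)
    size-bound x j xj#0 = begin-strict
      m                   ≡⟨ count-∁ (nonzero? Ax) ⟨
      size Ax ℕ.+ zeros   <⟨ ℕ.+-monoʳ-< (size Ax) (zeros<support x j xj#0) ⟩
      size Ax ℕ.+ size x  ≡⟨ ℕ.+-comm (size Ax) (size x) ⟩
      size x ℕ.+ size Ax  ∎
      where
      open ℕ.≤-Reasoning
      Ax    = λ i → A i ⊙ x
      zeros = count (¬? ∘ nonzero? Ax)

    -- A relation among the columns of A restricts to the first n rows, which form a nonsingular
    -- square submatrix.
    column-independence : n ≤ m → LinearlyIndependent (transpose A)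
    column-independence n≤m a Aa≈0 k =
      nonsingular⇒injective
        -- The index `k` of the coefficient in question witnesses that n is nonzero.
        (A-nonsingular _ {{nonZeroIndex k}} (λ i → inject≤ i n≤m) (inject≤-mono-< n≤m) id id)
        a (λ i → trans (sum-cong-≋ (λ k → *-comm _ (a k))) (Aa≈0 (inject≤ i n≤m))) k

    full-rank : n ≤ m → HasRank A n
    full-rank n≤m = transpose A
      -- The columns of A serve as the basis; row k of I gives the coefficients expressing column k.
      , (λ k → I k , λ i → sym (I-⊙ k (A i)))
      , column-independence n≤m
      , λ _ → id

    completely-unsparsifiable : n ≤ m → CompletelyUnsparsifiable A
    completely-unsparsifiable n≤m X X-invertible = begin
      (m ℕ.∸ n ℕ.+ 1) ℕ.* n                         ≡⟨ ℕ.*-comm _ n ⟩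
      n ℕ.* (m ℕ.∸ n ℕ.+ 1)                         ≡⟨ sum-const n _ ⟨
      Σℕ.sum {n} (λ _ → m ℕ.∸ n ℕ.+ 1)              ≤⟨ sum-mono-≤ column-bound ⟩
      Σℕ.sum (λ j → size (λ i → (A · X) i j))       ≡⟨ nnz-columns (A · X) ⟨
      nnz (A · X)                                   ∎
      where
      open ℕ.≤-Reasoning
      column-bound : ∀ j → m ℕ.∸ n ℕ.+ 1 ≤ size (λ i → (A · X) i j)
      column-bound j with i , Xij#0 ← invertible⇒column-nonzero X-invertible j = begin
        m ℕ.∸ n ℕ.+ 1   ≡⟨ ℕ.+-comm _ 1 ⟩
        1 ℕ.+ (m ℕ.∸ n) ≡⟨ ℕ.+-∸-assoc 1 n≤m ⟨
        -- A column of X has at most n nonzero entries, so the strict `size-bound` leaves at least m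
        -- + 1 - n for its image.
        suc m ℕ.∸ n     ≤⟨ ℕ.m≤n+o⇒m∸n≤o (suc m) n (ℕ.≤-trans (size-bound _ i Xij#0)
                             (ℕ.+-monoˡ-≤ _ (count≤n (nonzero? (λ i → X i j))))) ⟩
        size (λ i → (A · X) i j) ∎

    -- Each column of the stack has at most 1 + m nonzero entries, while a nonzero column x of X
    -- becomes x stacked above A x, with at least 1 + m of them.
    identity-stack-optimallySparse : OptimallySparse (I {n} ++ A)
    identity-stack-optimallySparse X X-invertible = begin
      nnz M                                     ≡⟨ nnz-columns M ⟩
      Σℕ.sum (λ j → size (λ i → M i j))         ≤⟨ sum-mono-≤ column-bound ⟩
      Σℕ.sum (λ j → size (λ i → (M · X) i j))   ≡⟨ nnz-columns (M · X) ⟨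
      nnz (M · X)                               ∎
      where
      open ℕ.≤-Reasoning
      M = I {n} ++ A
      column-bound : ∀ j → size (λ i → M i j) ≤ size (λ i → (M · X) i j)
      column-bound j with i , Xij#0 ← invertible⇒column-nonzero X-invertible j = begin
        size (λ i → M i j)
          ≡⟨ count-++ (λ row → row j #? 0#) I A ⟩
        size (λ i → I {n} i j) ℕ.+ size (λ i → A i j)
          ≤⟨ ℕ.+-mono-≤ (count-mono (nonzero? (λ i → I i j)) (_≟ j) (λ i → I-offDiagonal i j))
                        (count≤n (nonzero? (λ i → A i j))) ⟩
        count (_≟ j) ℕ.+ m
          ≡⟨ ≡.cong (ℕ._+ m) (count-≟ j) ⟩
        suc m
          ≤⟨ size-bound x i Xij#0 ⟩
        size x ℕ.+ size (λ i → A i ⊙ x)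
          ≤⟨ ℕ.+-monoˡ-≤ _ (count-mono (nonzero? x) (nonzero? (λ i → I i ⊙ x))
                             (λ i → #-congʳ (sym (I-⊙ i x)))) ⟩
        size (λ i → I i ⊙ x) ℕ.+ size (λ i → A i ⊙ x)
          -- Each row of `M` is tested by its product with x, so that splitting `M` into I and A
          -- splits the column of `M · X`.
          ≡⟨ count-++ (λ row → (row ⊙ x) #? 0#) I A ⟨
        size (λ i → (M · X) i j) ∎
        where x = λ i → X i j

mainTheorem4 : ∀ {c ℓ₁ ℓ₂} (F : HeytingField c ℓ₁ ℓ₂)
    (_#?_ : Decidable (HeytingField._#_ F)) →
    let open Matrices F _#?_ in
    ∀ {m n : ℕ} → n ≤ m → (A : Matrix m n) →
    EverySquareSubmatrixNonsingular A →
    HasRank A n × CompletelyUnsparsifiable A × OptimallySparse (I {n} ++ A)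
mainTheorem4 F _#?_ n≤m A A-nonsingular =
  full-rank A A-nonsingular n≤m
  , completely-unsparsifiable A A-nonsingular n≤m
  , identity-stack-optimallySparse A A-nonsingular
  where open MatrixProperties F _#?_
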